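{- Let $G=(V,E,w)$ be a weighted graph with treewidth ${\rm tw}$. Then $G$ admits a $(\beta,s)$-sparse cover scheme with $\beta=O(1)$ and $s=\mathrm{poly}({\rm tw})$, where the diameter guarantee holds with respect to strong diameter.
   Context: $G=(V,E,w)$ is a connected undirected graph with nonnegative edge weights and shortest-path metric $d_G$; $B_G(v,r)=\{u: d_G(u,v)\le r\}$. The strong diameter of a set $C\subseteq V$ is $\max_{u,v\in C} d_{G[C]}(u,v)$, where $G[C]$ is the induced subgraph. A collection $\mathcal{C}$ of subsets (clusters) of $V$ is a (strong) $(\beta,s,\Delta)$-sparse cover if every cluster has strong diameter at most $\Delta$, for every $v\in V$ the ball $B_G(v,\Delta/\beta)$ is contained in some cluster of $\mathcal{C}$, and every vertex belongs to at most $s$ clusters. $G$ admits a $(\beta,s)$-sparse cover scheme if it admits a $(\beta,s,\Delta)$-sparse cover for every $\Delta>0$. $\mathrm{poly}({\rm tw})$ means bounded by a fixed polynomial in ${\rm tw}$.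
   Formalization: The edge weights and the diameter parameter Δ are taken to be nonnegative (respectively positive) rational numbers instead of real numbers. -}

module Defs where

open import Data.Nat as ℕ using (ℕ; suc; _^_)
open import Data.Fin using (Fin)
open import Data.Fin.Subset using (Subset; _∈_)
open import Data.Fin.Subset.Properties using (_∈?_)
open import Data.List using (List; length; filter)
open import Data.List.Relation.Unary.All using (All)
import Data.List.Membership.Propositional as LMem
open import Data.Product using (Σ; _×_; _,_; ∃; proj₁; proj₂)
open import Data.Sum using (_⊎_)
open import Data.Rational as ℚ using (ℚ; 0ℚ; _+_; _÷_; _≤_; Positive)
open import Data.Rational.Properties using (pos⇒nonZero)
open import Relation.Nullary using (¬_)
open import Data.Unit using (⊤)
open import Relation.Binary.PropositionalEquality using (_≡_)

-- Weighted graphs on vertex set Fin n.  An edge is (u , v , w(uv)).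
-- Undirected: an edge can be traversed in both directions.

WEdge : ℕ → Set
WEdge n = Fin n × Fin n × ℚ

Adj : ∀ {n} → List (WEdge n) → Fin n → Fin n → ℚ → Set
Adj E u v q = LMem._∈_ (u , v , q) E ⊎ LMem._∈_ (v , u , q) E

NonNegWeights : ∀ {n} → List (WEdge n) → Set
NonNegWeights E = All (λ e → 0ℚ ≤ proj₂ (proj₂ e)) E

data Walk {n} (E : List (WEdge n)) (P : Fin n → Set) : Fin n → Fin n → ℚ → Set where
  here : ∀ {u} → P u → Walk E P u u 0ℚ
  step : ∀ {u v x q ℓ} → P u → Adj E u v q → Walk E P v x ℓ → Walk E P u x (q + ℓ)

Everything : ∀ {n} → Fin n → Set
Everything _ = ⊤

-- d_G(u,v) ≤ r  (in a finite graph the shortest-path distance is attained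
-- by a walk, so this is exactly the statement d_G(u,v) ≤ r)
Dist≤ : ∀ {n} → List (WEdge n) → Fin n → Fin n → ℚ → Set
Dist≤ E u v r = Σ ℚ λ ℓ → Walk E Everything u v ℓ × ℓ ≤ r

Connected : ∀ {n} → List (WEdge n) → Set
Connected {n} E = (u v : Fin n) → Σ ℚ λ ℓ → Walk E Everything u v ℓ

StrongDiam≤ : ∀ {n} → List (WEdge n) → Subset n → ℚ → Set
StrongDiam≤ {n} E C Δ =
  (u v : Fin n) → u ∈ C → v ∈ C → Σ ℚ λ ℓ → Walk E (λ x → x ∈ C) u v ℓ × ℓ ≤ Δ

data Reach {m} (T : List (Fin m × Fin m)) (P : Fin m → Set) : Fin m → Fin m → Set where
  here : ∀ {a} → P a → Reach T P a a
  step : ∀ {a b c} → P a → (LMem._∈_ (a , b) T ⊎ LMem._∈_ (b , a) T) →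
         Reach T P b c → Reach T P a c

record TreeDecomposition {n} (E : List (WEdge n)) (k : ℕ) : Set where
  field
    m       : ℕ
    tedges  : List (Fin m × Fin m)
    -- T is a tree: m ≥ 1 nodes, m - 1 edges, connected
    nodes≥1 : 1 ℕ.≤ m
    edges   : suc (length tedges) ≡ m
    tconn   : (a b : Fin m) → Reach tedges (λ _ → ⊤) a b
    bag     : Fin m → List (Fin n)
    cover   : (v : Fin n) → Σ (Fin m) λ t → LMem._∈_ v (bag t)
    edgeIn  : ∀ u v q → LMem._∈_ (u , v , q) E →
              Σ (Fin m) λ t → LMem._∈_ u (bag t) × LMem._∈_ v (bag t)
    subtree : (v : Fin n) (a b : Fin m) → LMem._∈_ v (bag a) → LMem._∈_ v (bag b) →
              Reach tedges (λ t → LMem._∈_ v (bag t)) a b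
    width   : (t : Fin m) → length (bag t) ℕ.≤ suc k

Treewidth : ∀ {n} → List (WEdge n) → ℕ → Set
Treewidth E tw = TreeDecomposition E tw × (∀ k → k ℕ.< tw → ¬ TreeDecomposition E k)

radius : (Δ β : ℚ) → Positive β → ℚ
radius Δ β pβ = _÷_ Δ β {{pos⇒nonZero β {{pβ}}}}

load : ∀ {n} → List (Subset n) → Fin n → ℕ
load 𝒞 v = length (filter (v ∈?_) 𝒞)

record SparseCover {n} (E : List (WEdge n)) (β : ℚ) (pβ : Positive β) (s : ℕ) (Δ : ℚ)
                   (𝒞 : List (Subset n)) : Set where
  field
    diam   : All (λ C → StrongDiam≤ E C Δ) 𝒞
    balls  : (v : Fin n) → Σ (Subset n) λ C → LMem._∈_ C 𝒞 ×
             ((u : Fin n) → Dist≤ E u v (radius Δ β pβ) → u ∈ C)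
    sparse : (v : Fin n) → load 𝒞 v ℕ.≤ s

SparseCoverScheme : ∀ {n} → List (WEdge n) → (β : ℚ) → Positive β → ℕ → Set
SparseCoverScheme {n} E β pβ s =
  (Δ : ℚ) → Positive Δ → Σ (List (Subset n)) λ 𝒞 → SparseCover E β pβ s Δ 𝒞

{-# OPTIONS --safe #-}
-- Root the tree decomposition, let X t be the bag of t and V t the union of the bags below t, and put
-- δ = Δ / 8, ρ = 2 δ.  Going down from the root, keep a stack of frames (s , H), each with the core of
-- all vertices within ρ of X s in the graph induced on H ∩ V s.  At a node t, the stack is cut at its
-- lowest frame (s , H) whose core misses X t, and (t , H) replaces that frame; if no core misses X t,
-- a frame is added on top.  Frames above (s , H) live in what shrink s H leaves of H, so cores on
-- a stack are disjoint and there are at most tw + 2 of them.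
--
-- Covering: take the highest node t whose bag meets a ball of radius δ.  The lowest core on the stack of
-- t that meets the ball lies within ρ of all of it, in a graph that contains the ball, so the ball of
-- radius 2 ρ about some z ∈ X s contains it.  The clusters collect these larger balls by their center z,
-- and contain apart from z only vertices all of whose bags are below s.
--
-- Load: go down to a bag of u and count the frames that see u, i.e. have it within 2 ρ.  As long as no
-- popped frame has seen u, these are all on the stack.  The first time a frame that sees u is popped, the
-- frame that replaces the lowest popped one has u in its core: either it was popped by the lack of
-- its own core in the bag, which uses up ρ of the distance 2 ρ, or by a lower frame, and then this is
-- part of the definition of shrink.  From then on u is always in the core of some frame, which hides u from
-- the frames above it, and whenever that frame is popped it is replaced by one at a smaller height.
-- So O(tw) frames, hence O(tw²) centers, see u.

module Submission where

open import Defs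
open import Data.Nat using (ℕ; suc; _*_; _^_)
open import Data.Fin using (Fin)
open import Data.List using (List)
open import Data.Product using (Σ)
open import Data.Rational using (ℚ; Positive)

open import Data.Empty using (⊥-elim)
import Data.Fin as Fin using (fromℕ<)
import Data.Fin.Properties as Fin
open import Data.Fin.Subset using (Subset; _∈_; _∉_; _-_; ∣_∣; ⊤)
open import Data.Fin.Subset.Properties using (_∈?_; ∈⊤; x∈p∧x≢y⇒x∈p-y; x∈p⇒∣p-x∣<∣p∣; p─q⊆p)
import Data.Integer as ℤ using (+_)
open import Data.List using ([]; _∷_; _++_; length; filter; map; concatMap; allFin)
open import Data.List.Membership.Propositional using (find; lose) renaming (_∈_ to _∈ₗ_; _∉_ to _∉ₗ_)
open import Data.List.Membership.Propositional.Properties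
  using (∈-∃++; ∈-map⁺; ∈-concat⁺′; ∈-filter⁻; ∈-allFin; ∈-++⁻; ∈-++⁺ˡ; ∈-++⁺ʳ)
open import Data.List.Properties using (length-++; length-filter; length-tabulate)
import Data.List.Relation.Unary.All as All
import Data.List.Relation.Unary.All.Properties as All
open import Data.List.Relation.Unary.AllPairs using ([]; _∷_)
open import Data.List.Relation.Unary.Any using (Any; here; there; any?)
open import Data.List.Relation.Unary.Unique.Propositional using (Unique)
open import Data.List.Relation.Unary.Unique.Propositional.Properties using (allFin⁺; filter⁺)
open import Data.Nat using (zero; s≤s; z≤n)
import Data.Nat as ℕ
import Data.Nat.Properties as ℕ
open import Data.Nat.Tactic.RingSolver using (solve-∀)
open import Data.Product using (_×_; _,_; ∃; proj₁; proj₂)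
open import Data.Rational using (0ℚ; _+_; _≤_; _≤?_; _/_) renaming (_*_ to _ℚ*_)
import Data.Rational.Properties as ℚ
open import Data.Sum as Sum using (_⊎_; inj₁; inj₂)
open import Data.Unit using (tt) renaming (⊤ to Unit)
open import Data.Vec using (tabulate)
open import Data.Vec.Properties using (lookup∘tabulate; lookup⇒[]=; []=⇒lookup)
open import Function using (_∘_; id)
open import Relation.Binary.PropositionalEquality using (_≡_; refl; sym; trans; cong; subst)
open import Relation.Nullary using (¬_; Dec; yes; no; does; contradiction)
open import Relation.Nullary.Decidable
  using (decidable-stable; dec-true; map′; _×-dec_; _⊎-dec_; ¬?; _→-dec_)

-- Subsets and lists

module _ {n : ℕ} {P : Fin n → Set} (P? : ∀ x → Dec (P x)) where

  abstract
    comprehension : Subset n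
    comprehension = tabulate (does ∘ P?)

    ∈-comprehension⁺ : ∀ {x} → P x → x ∈ comprehension
    ∈-comprehension⁺ {x} px = lookup⇒[]= x comprehension (trans (lookup∘tabulate (does ∘ P?) x) (dec-true (P? x) px))

    ∈-comprehension⁻ : ∀ {x} → x ∈ comprehension → P x
    ∈-comprehension⁻ {x} x∈ with P? x | trans (sym (lookup∘tabulate (does ∘ P?) x)) ([]=⇒lookup x∈)
    ... | yes px | _ = px
    ... | no _ | ()

module _ {m : ℕ} where
  open import Data.List.Membership.DecPropositional (Fin._≟_ {m}) public using () renaming (_∈?_ to _∈ₗ?_)

any∈? : ∀ {a} {A : Set a} {P : A → Set} → (∀ x → Dec (P x)) → ∀ xs → Dec (∃ λ x → x ∈ₗ xs × P x)
any∈? P? xs = map′ find (λ (x , x∈ , px) → lose x∈ px) (any? P? xs)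

unique-⊆⇒length≤ : ∀ {a} {A : Set a} {xs ys : List A} → Unique xs → (∀ {x} → x ∈ₗ xs → x ∈ₗ ys) →
                   length xs ℕ.≤ length ys
unique-⊆⇒length≤ [] _ = z≤n
unique-⊆⇒length≤ {xs = x ∷ xs} (x∉ ∷ u) sub with ∈-∃++ (sub (here refl))
... | as , bs , refl = ℕ.≤-trans (s≤s (unique-⊆⇒length≤ {ys = as ++ bs} u sub′)) (ℕ.≤-reflexive eq)
  where
  sub′ : ∀ {y} → y ∈ₗ xs → y ∈ₗ as ++ bs
  sub′ y∈ with ∈-++⁻ as (sub (there y∈))
  ... | inj₁ y∈as = ∈-++⁺ˡ y∈as
  ... | inj₂ (here refl) = contradiction refl (All.lookup x∉ y∈)
  ... | inj₂ (there y∈bs) = ∈-++⁺ʳ as y∈bs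
  eq : suc (length (as ++ bs)) ≡ length (as ++ x ∷ bs)
  eq = trans (cong suc (length-++ as)) (trans (sym (ℕ.+-suc (length as) (length bs))) (sym (length-++ as)))

length-filter-≤ : ∀ {a} {A : Set a} {P Q : A → Set} (P? : ∀ x → Dec (P x)) (Q? : ∀ x → Dec (Q x)) →
  (∀ {x} → P x → Q x) → ∀ xs → length (filter P? xs) ℕ.≤ length (filter Q? xs)
length-filter-≤ P? Q? P⇒Q [] = z≤n
length-filter-≤ P? Q? P⇒Q (x ∷ xs) with P? x | Q? x
... | yes p | yes q = s≤s (length-filter-≤ P? Q? P⇒Q xs)
... | yes p | no ¬q = contradiction (P⇒Q p) ¬q
... | no ¬p | yes q = ℕ.m≤n⇒m≤1+n (length-filter-≤ P? Q? P⇒Q xs)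
... | no ¬p | no ¬q = length-filter-≤ P? Q? P⇒Q xs

length-filter-< : ∀ {a} {A : Set a} {P Q : A → Set} (P? : ∀ x → Dec (P x)) (Q? : ∀ x → Dec (Q x)) →
  (∀ {x} → P x → Q x) → ∀ {x xs} → x ∈ₗ xs → Q x → ¬ P x →
  length (filter P? xs) ℕ.< length (filter Q? xs)
length-filter-< P? Q? P⇒Q {x} {_ ∷ xs} (here refl) qx ¬px with P? x | Q? x
... | yes p | _ = contradiction p ¬px
... | no _ | yes _ = s≤s (length-filter-≤ P? Q? P⇒Q xs)
... | no _ | no ¬q = contradiction qx ¬q
length-filter-< P? Q? P⇒Q {xs = y ∷ xs} (there x∈) qx ¬px with P? y | Q? y
... | yes p | yes q = s≤s (length-filter-< P? Q? P⇒Q x∈ qx ¬px)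
... | yes p | no ¬q = contradiction (P⇒Q p) ¬q
... | no ¬p | yes q = ℕ.m≤n⇒m≤1+n (length-filter-< P? Q? P⇒Q x∈ qx ¬px)
... | no ¬p | no ¬q = length-filter-< P? Q? P⇒Q x∈ qx ¬px

length-filter-map : ∀ {a b} {A : Set a} {B : Set b} {P : B → Set} (P? : ∀ x → Dec (P x)) (f : A → B) xs →
  length (filter P? (map f xs)) ≡ length (filter (P? ∘ f) xs)
length-filter-map P? f [] = refl
length-filter-map P? f (x ∷ xs) with P? (f x)
... | yes _ = cong suc (length-filter-map P? f xs)
... | no _ = length-filter-map P? f xs

length-concatMap : ∀ {a b} {A : Set a} {B : Set b} (f : A → List B) {c} → (∀ x → length (f x) ℕ.≤ c) →
  ∀ xs → length (concatMap f xs) ℕ.≤ length xs * c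
length-concatMap f bd [] = z≤n
length-concatMap f bd (x ∷ xs) =
  ℕ.≤-trans (ℕ.≤-reflexive (length-++ (f x))) (ℕ.+-mono-≤ (bd x) (length-concatMap f bd xs))

-- Walks

Within : ∀ {n} → List (WEdge n) → (Fin n → Set) → ℚ → Fin n → Fin n → Set
Within E P r u v = Σ ℚ λ ℓ → Walk E P u v ℓ × ℓ ≤ r

module Walks {n : ℕ} (E : List (WEdge n)) (nonneg : NonNegWeights E) where

  adj-nonneg : ∀ {u v q} → Adj E u v q → 0ℚ ≤ q
  adj-nonneg (inj₁ e∈) = All.lookup nonneg e∈
  adj-nonneg (inj₂ e∈) = All.lookup nonneg e∈

  adj-sym : ∀ {u v q} → Adj E u v q → Adj E v u q
  adj-sym (inj₁ e∈) = inj₂ e∈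
  adj-sym (inj₂ e∈) = inj₁ e∈

  private variable
    P Q : Fin n → Set
    u v w : Fin n
    ℓ r r′ : ℚ

  walk-map : (∀ {x} → P x → Q x) → Walk E P u v ℓ → Walk E Q u v ℓ
  walk-map f (here p) = here (f p)
  walk-map f (step p e w) = step (f p) e (walk-map f w)

  walk-start : Walk E P u v ℓ → P u
  walk-start (here p) = p
  walk-start (step p _ _) = p

  walk-end : Walk E P u v ℓ → P v
  walk-end (here p) = p
  walk-end (step _ _ w) = walk-end w

  walk-nonneg : Walk E P u v ℓ → 0ℚ ≤ ℓ
  walk-nonneg (here _) = ℚ.≤-refl
  walk-nonneg (step _ e w) = ℚ.+-mono-≤ (adj-nonneg e) (walk-nonneg w)

  ≤-prepend : ∀ {q a b} → 0ℚ ≤ q → a ≤ b → a ≤ q + b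
  ≤-prepend {q} {a} {b} q≥0 a≤b = subst (_≤ q + b) (ℚ.+-identityˡ a) (ℚ.+-mono-≤ q≥0 a≤b)

  walk-++ : ∀ {ℓ₁ ℓ₂} → Walk E P u v ℓ₁ → Walk E P v w ℓ₂ → Walk E P u w (ℓ₁ + ℓ₂)
  walk-++ {ℓ₂ = ℓ₂} (here _) w₂ = subst (Walk E _ _ _) (sym (ℚ.+-identityˡ ℓ₂)) w₂
  walk-++ {ℓ₂ = ℓ₂} (step {q = q} {ℓ} p e w₁) w₂ =
    subst (Walk E _ _ _) (sym (ℚ.+-assoc q ℓ ℓ₂)) (step p e (walk-++ w₁ w₂))

  walk-reverse : Walk E P u v ℓ → Walk E P v u ℓ
  walk-reverse (here p) = here p
  walk-reverse (step {q = q} {ℓ} p e w) =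
    subst (Walk E _ _ _) (trans (cong (ℓ +_) (ℚ.+-identityʳ q)) (ℚ.+-comm ℓ q))
      (walk-++ (walk-reverse w) (step (walk-start w) (adj-sym e) (here p)))

  within-++ : Within E P r u v → Within E P r′ v w → Within E P (r + r′) u w
  within-++ (_ , w₁ , ≤₁) (_ , w₂ , ≤₂) = _ , walk-++ w₁ w₂ , ℚ.+-mono-≤ ≤₁ ≤₂

  within-reverse : Within E P r u v → Within E P r v u
  within-reverse (_ , w , ≤r) = _ , walk-reverse w , ≤r

  within-map : (∀ {x} → P x → Q x) → Within E P r u v → Within E Q r u v
  within-map f (_ , w , ≤r) = _ , walk-map f w , ≤r

  -- What remains of the walk from any of its vertices is no longer than the whole, so that vertex
  -- lies in the ball as well. Hence a ball is connected within itself, which yields strong rather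
  -- than weak diameter.
  walk-localize : Walk E P u v ℓ → ℓ ≤ r → Walk E (λ x → Within E P r x v) u v ℓ
  walk-localize w@(here _) ≤r = here (_ , w , ≤r)
  walk-localize w@(step p e w′) ≤r =
    step (_ , w , ≤r) e (walk-localize w′ (ℚ.≤-trans (≤-prepend (adj-nonneg e) ℚ.≤-refl) ≤r))

  within-localize : Within E P r u v → Within E (λ x → Within E P r x v) r u v
  within-localize (_ , w , ≤r) = _ , walk-localize w ≤r , ≤r

  -- A walk from u may be shortened so that it never returns to u; this bounds the search below.
  Exit : Subset n → Fin n → Fin n → ℚ → Set
  Exit S u v ℓ = (u ≡ v × 0ℚ ≤ ℓ) ⊎
    (∃ λ w → ∃ λ q → ∃ λ ℓ′ → Adj E u w q × Walk E (_∈ S - u) w v ℓ′ × q + ℓ′ ≤ ℓ)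

  exit-weaken : ∀ {S u v ℓ ℓ′} → ℓ ≤ ℓ′ → Exit S u v ℓ → Exit S u v ℓ′
  exit-weaken le (inj₁ (eq , ≥0)) = inj₁ (eq , ℚ.≤-trans ≥0 le)
  exit-weaken le (inj₂ (w , q , ℓ′ , e , wk , ≤ℓ)) = inj₂ (w , q , ℓ′ , e , wk , ℚ.≤-trans ≤ℓ le)

  -- Cut at the last visit to `u`: what follows avoids `u`, and dropping what precedes cannot
  -- increase the length.
  avoid-or-exit : ∀ {S w v ℓ} u → Walk E (_∈ S) w v ℓ → Walk E (_∈ S - u) w v ℓ ⊎ Exit S u v ℓ
  avoid-or-exit {w = w} u (here p) with w Fin.≟ u
  ... | yes refl = inj₂ (inj₁ (refl , ℚ.≤-refl))
  ... | no w≢u = inj₁ (here (x∈p∧x≢y⇒x∈p-y p w≢u))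
  avoid-or-exit {w = w} u (step p e wk) with avoid-or-exit u wk | w Fin.≟ u
  ... | inj₂ ex | _ = inj₂ (exit-weaken (≤-prepend (adj-nonneg e) ℚ.≤-refl) ex)
  ... | inj₁ wk′ | yes refl = inj₂ (inj₂ (_ , _ , _ , e , wk′ , ℚ.≤-refl))
  ... | inj₁ wk′ | no w≢u = inj₁ (step (x∈p∧x≢y⇒x∈p-y p w≢u) e wk′)

  walk-exit : ∀ {S u v ℓ} → Walk E (_∈ S) u v ℓ → Exit S u v ℓ
  walk-exit (here p) = inj₁ (refl , ℚ.≤-refl)
  walk-exit {u = u} (step p e wk) with avoid-or-exit u wk
  ... | inj₂ ex = exit-weaken (≤-prepend (adj-nonneg e) ℚ.≤-refl) ex
  ... | inj₁ wk′ = inj₂ (_ , _ , _ , e , wk′ , ℚ.≤-refl)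

  private
    -- `a` is the length already spent on the way to `u`, so the search only adds and compares.
    Budget : Subset n → ℚ → Fin n → Fin n → ℚ → Set
    Budget S a u v r = Σ ℚ λ ℓ → Walk E (_∈ S) u v ℓ × a + ℓ ≤ r

    First : Subset n → ℚ → Fin n → Fin n → ℚ → WEdge n → Set
    First S a u v r (x , y , q) =
      (u ≡ x × Budget (S - u) (a + q) y v r) ⊎ (u ≡ y × Budget (S - u) (a + q) x v r)

    grow : ∀ {S q u v w r} a → u ∈ S → Adj E u w q → Budget (S - u) (a + q) w v r → Budget S a u v r
    grow {S} {q} {u} a u∈S e (ℓ , wk , ≤r) =
      q + ℓ , step u∈S e (walk-map (p─q⊆p S _) wk) , subst (_≤ _) (ℚ.+-assoc a q ℓ) ≤r

    -- Exhaustive search over first edges. By `walk-exit` it loses nothing to delete `u` from `S`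
    -- after leaving it, and this makes `k` a bound on the depth.
    budget? : ∀ k S → ∣ S ∣ ℕ.≤ k → ∀ a u v r → Dec (Budget S a u v r)
    budget? k S ≤k a u v r with u ∈? S
    ... | no u∉ = no λ (_ , wk , _) → u∉ (walk-start wk)
    ... | yes u∈ with k | ℕ.≤-trans (x∈p⇒∣p-x∣<∣p∣ u∈) ≤k
    ... | suc k | s≤s ≤k′ with u Fin.≟ v ×-dec a + 0ℚ ≤? r | any? first? E
      where
      first? : ∀ e → Dec (First S a u v r e)
      first? (x , y , q) =
        (u Fin.≟ x ×-dec budget? k (S - u) ≤k′ (a + q) y v r) ⊎-dec
        (u Fin.≟ y ×-dec budget? k (S - u) ≤k′ (a + q) x v r)
    ... | yes (refl , ≤r) | _ = yes (0ℚ , here u∈ , ≤r)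
    ... | no _ | yes any = yes (start (find any))
      where
      start : (∃ λ e → e ∈ₗ E × First S a u v r e) → Budget S a u v r
      start (_ , e∈ , inj₁ (refl , b)) = grow a u∈ (inj₁ e∈) b
      start (_ , e∈ , inj₂ (refl , b)) = grow a u∈ (inj₂ e∈) b
    ... | no ¬here | no ¬step = no λ (ℓ , wk , ≤r) → stuck ≤r (walk-exit wk)
      where
      stuck : ∀ {ℓ} → a + ℓ ≤ r → ¬ Exit S u v ℓ
      stuck ≤r (inj₁ (refl , ≥0)) = ¬here (refl , ℚ.≤-trans (ℚ.+-monoʳ-≤ a ≥0) ≤r)
      stuck ≤r (inj₂ (w , q , ℓ′ , e , wk , le)) = ¬step (found e)
        where
        b : Budget (S - u) (a + q) w v r
        b = ℓ′ , wk , ℚ.≤-trans (subst (_≤ a + _) (sym (ℚ.+-assoc a q ℓ′)) (ℚ.+-monoʳ-≤ a le)) ≤r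
        found : Adj E u w q → Any (First S a u v r) E
        found (inj₁ e∈) = lose e∈ (inj₁ (refl , b))
        found (inj₂ e∈) = lose e∈ (inj₂ (refl , b))

  abstract
    within? : (∀ x → Dec (P x)) → ∀ r u v → Dec (Within E P r u v)
    within? P? r u v = map′
      (λ (ℓ , wk , ≤r) → ℓ , walk-map (∈-comprehension⁻ P?) wk , subst (_≤ r) (ℚ.+-identityˡ ℓ) ≤r)
      (λ (ℓ , wk , ≤r) → ℓ , walk-map (∈-comprehension⁺ P?) wk , subst (_≤ r) (sym (ℚ.+-identityˡ ℓ)) ≤r)
      (budget? _ (comprehension P?) ℕ.≤-refl 0ℚ u v r)

-- Rooted trees

-- path t lists the nodes from t up to the root.
record Rooting {m} (T : List (Fin m × Fin m)) : Set where
  field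
    path : Fin m → List (Fin m)
    path-cons : ∀ t → ∃ λ r → path t ≡ t ∷ r × (r ≡ [] ⊎ ∃ λ p → r ≡ path p)
    path-edge : ∀ {a b} → (a , b) ∈ₗ T → path a ≡ a ∷ path b ⊎ path b ≡ b ∷ path a

-- A subtree grown from the root consumes one edge for each node it adds, so with only m - 1 edges
-- none is left over when all nodes have been reached.
module _ {m : ℕ} {T : List (Fin m × Fin m)} (conn : (a b : Fin m) → Reach T (λ _ → Unit) a b) where

  private
    record Growth (rest : List (Fin m × Fin m)) : Set where
      field
        path : Fin m → List (Fin m)
        reached : List (Fin m)
        root : Fin m
        root∈ : root ∈ₗ reached
        path-cons : ∀ {t} → t ∈ₗ reached →
          ∃ λ r → path t ≡ t ∷ r × (r ≡ [] ⊎ ∃ λ p → p ∈ₗ reached × r ≡ path p)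
        edges : ∀ {a b} → (a , b) ∈ₗ T → (a , b) ∈ₗ rest ⊎
          (a ∈ₗ reached × b ∈ₗ reached × (path a ≡ a ∷ path b ⊎ path b ≡ b ∷ path a))
        count : length reached ℕ.+ length rest ≡ m

    crossing : ∀ {P} {xs : List (Fin m)} {a b} → Reach T P a b → a ∈ₗ xs → b ∉ₗ xs →
      ∃ λ x → ∃ λ y → x ∈ₗ xs × y ∉ₗ xs × ((x , y) ∈ₗ T ⊎ (y , x) ∈ₗ T)
    crossing (here _) a∈ b∉ = contradiction a∈ b∉
    crossing {xs = xs} (step {b = b} _ e w) a∈ b∉ with b ∈ₗ? xs
    ... | yes b∈ = crossing w b∈ b∉
    ... | no b∉′ = _ , b , a∈ , b∉′ , e

    unreached : (xs : List (Fin m)) → length xs ℕ.< m → ∃ λ b → b ∉ₗ xs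
    unreached xs lt with Fin.any? (λ b → ¬? (b ∈ₗ? xs))
    ... | yes found = found
    ... | no none = contradiction lt (ℕ.≤⇒≯ (subst (ℕ._≤ length xs) (length-tabulate id)
      (unique-⊆⇒length≤ (allFin⁺ m) λ {b} _ → decidable-stable (b ∈ₗ? xs) λ b∉ → none (b , b∉))))

    remove : ∀ {A : Set} {e : A} {xs} → e ∈ₗ xs →
      ∃ λ ys → length xs ≡ suc (length ys) × (∀ {e′} → e′ ∈ₗ xs → e′ ≡ e ⊎ e′ ∈ₗ ys)
    remove (here {xs = xs} refl) = xs , refl , λ { (here eq) → inj₁ eq ; (there i) → inj₂ i }
    remove (there {x} i) with remove i
    ... | ys , len , split = x ∷ ys , cong suc len ,
      λ { (here eq) → inj₂ (here eq) ; (there j) → Sum.map₂ there (split j) }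

    module Attach {rest} (g : Growth rest) {x y}
      (x∈ : x ∈ₗ Growth.reached g) (y∉ : y ∉ₗ Growth.reached g) where

      open Growth g

      path′ : Fin m → List (Fin m)
      path′ t with t Fin.≟ y
      ... | yes _ = y ∷ path x
      ... | no _ = path t

      path′-old : ∀ {t} → t ∈ₗ reached → path′ t ≡ path t
      path′-old {t} t∈ with t Fin.≟ y
      ... | yes refl = contradiction t∈ y∉
      ... | no _ = refl

      path′-new : path′ y ≡ y ∷ path′ x
      path′-new with y Fin.≟ y
      ... | yes _ = cong (y ∷_) (sym (path′-old x∈))
      ... | no y≢y = contradiction refl y≢y

      attach : ∀ {rest′} → length rest ≡ suc (length rest′) →
        (∀ {a b} → (a , b) ∈ₗ rest → ((a , b) ≡ (x , y) ⊎ (a , b) ≡ (y , x)) ⊎ (a , b) ∈ₗ rest′) →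
        Growth rest′
      attach {rest′} len split = record
        { path = path′
        ; reached = y ∷ reached
        ; root = root
        ; root∈ = there root∈
        ; path-cons = cons′
        ; edges = edges′
        ; count = trans (sym (trans (cong (length reached ℕ.+_) len) (ℕ.+-suc _ _))) count
        }
        where
        cons′ : ∀ {t} → t ∈ₗ y ∷ reached →
          ∃ λ r → path′ t ≡ t ∷ r × (r ≡ [] ⊎ ∃ λ p → p ∈ₗ y ∷ reached × r ≡ path′ p)
        cons′ (here refl) = path′ x , path′-new , inj₂ (x , there x∈ , refl)
        cons′ (there t∈) with path-cons t∈
        ... | r , eq , inj₁ r≡[] = r , trans (path′-old t∈) eq , inj₁ r≡[]
        ... | r , eq , inj₂ (p , p∈ , r≡) =
          r , trans (path′-old t∈) eq , inj₂ (p , there p∈ , trans r≡ (sym (path′-old p∈)))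
        edges′ : ∀ {a b} → (a , b) ∈ₗ T → (a , b) ∈ₗ rest′ ⊎
          (a ∈ₗ y ∷ reached × b ∈ₗ y ∷ reached × (path′ a ≡ a ∷ path′ b ⊎ path′ b ≡ b ∷ path′ a))
        edges′ {a} {b} e∈ with edges e∈
        ... | inj₂ (a∈ , b∈ , rel) = inj₂ (there a∈ , there b∈ , Sum.map
                (λ eq → trans (path′-old a∈) (trans eq (cong (a ∷_) (sym (path′-old b∈)))))
                (λ eq → trans (path′-old b∈) (trans eq (cong (b ∷_) (sym (path′-old a∈))))) rel)
        ... | inj₁ e∈rest with split e∈rest
        ... | inj₂ e∈′ = inj₁ e∈′
        ... | inj₁ (inj₁ refl) = inj₂ (there x∈ , here refl , inj₂ path′-new)
        ... | inj₁ (inj₂ refl) = inj₂ (here refl , there x∈ , inj₁ path′-new)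

    -- A tree path from the root to an unreached node leaves `reached` along some edge. Used edges
    -- have both ends reached, so this one is still in `rest` and can attach its outer end.
    extend : ∀ {e rest} → Growth (e ∷ rest) → ∃ λ rest′ → length rest′ ≡ length rest × Growth rest′
    extend {e} {rest} g = go (crossing (conn root b) root∈ b∉)
      where
      open Growth g
      new : ∃ λ b → b ∉ₗ reached
      new = unreached reached (subst (length reached ℕ.<_) count (ℕ.m<m+n _ (s≤s z≤n)))
      b = proj₁ new
      b∉ = proj₂ new
      go : (∃ λ x → ∃ λ y → x ∈ₗ reached × y ∉ₗ reached × ((x , y) ∈ₗ T ⊎ (y , x) ∈ₗ T)) → _
      go (x , y , x∈ , y∉ , inj₁ e∈) with edges e∈
      ... | inj₂ (_ , y∈ , _) = contradiction y∈ y∉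
      ... | inj₁ e∈rest with remove e∈rest
      ... | rest′ , len , split = rest′ , sym (ℕ.suc-injective len) ,
              Attach.attach g x∈ y∉ len (Sum.map₁ inj₁ ∘ split)
      go (x , y , x∈ , y∉ , inj₂ e∈) with edges e∈
      ... | inj₂ (y∈ , _ , _) = contradiction y∈ y∉
      ... | inj₁ e∈rest with remove e∈rest
      ... | rest′ , len , split = rest′ , sym (ℕ.suc-injective len) ,
              Attach.attach g x∈ y∉ len (Sum.map₁ inj₂ ∘ split)

    complete : ∀ k {rest} → length rest ≡ k → Growth rest → Growth []
    complete _ {[]} _ g = g
    complete (suc k) {_ ∷ _} eq g with extend g
    ... | rest′ , len , g′ = complete k (trans len (ℕ.suc-injective eq)) g′

    reaches : (g : Growth []) → ∀ {P a b} → Reach T P a b → a ∈ₗ Growth.reached g → b ∈ₗ Growth.reached g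
    reaches g (here _) a∈ = a∈
    reaches g (step _ (inj₁ e) w) a∈ with Growth.edges g e
    ... | inj₂ (_ , b∈ , _) = reaches g w b∈
    reaches g (step _ (inj₂ e) w) a∈ with Growth.edges g e
    ... | inj₂ (b∈ , _ , _) = reaches g w b∈

  rooting : Fin m → suc (length T) ≡ m → Rooting T
  rooting t₀ size = record
    { path = path
    ; path-cons = λ t → let r , eq , tail = path-cons (reaches g (conn root t) root∈)
                        in r , eq , Sum.map₂ (λ (p , _ , r≡) → p , r≡) tail
    ; path-edge = λ e∈ → used (edges e∈)
    }
    where
    seed : Growth T
    seed = record
      { path = _∷ []
      ; reached = t₀ ∷ []
      ; root = t₀
      ; root∈ = here refl
      ; path-cons = λ { (here refl) → [] , refl , inj₁ refl }
      ; edges = inj₁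
      ; count = size
      }
    g = complete _ refl seed
    open Growth g
    used : ∀ {A : Set} {e : Fin m × Fin m} {B C : Set} → e ∈ₗ [] ⊎ (A × B × C) → C
    used (inj₂ (_ , _ , c)) = c

module RootedTree {m : ℕ} {T : List (Fin m × Fin m)} (rooted : Rooting T) where
  open Rooting rooted

  infix 4 _≼_ _≼?_

  _≼_ : Fin m → Fin m → Set
  s ≼ t = s ∈ₗ path t

  _≼?_ : ∀ s t → Dec (s ≼ t)
  s ≼? t = s ∈ₗ? path t

  ≼-refl : ∀ {t} → t ≼ t
  ≼-refl {t} with path-cons t
  ... | r , eq , _ = subst (t ∈ₗ_) (sym eq) (here refl)

  private
    suffix′ : ∀ l {t u} → path u ≡ l → t ∈ₗ l → ∃ λ pre → l ≡ pre ++ path t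
    suffix′ (_ ∷ r) {t} {u} eq t∈ with path-cons u
    suffix′ (_ ∷ r) {t} {u} eq (here refl) | r′ , eq′ , _ with trans (sym eq) eq′
    ... | refl = [] , sym eq
    suffix′ (x ∷ r) {t} {u} eq (there t∈) | r′ , eq′ , tail with trans (sym eq) eq′
    suffix′ (x ∷ r) {t} {u} eq (there ()) | _ , _ , inj₁ refl | refl
    suffix′ (x ∷ r) {t} {u} eq (there t∈) | r′ , eq′ , inj₂ (p , r≡) | refl with suffix′ r (sym r≡) t∈
    ... | pre , eq″ = x ∷ pre , cong (x ∷_) eq″

  suffix : ∀ {t u} → t ≼ u → ∃ λ pre → path u ≡ pre ++ path t
  suffix {u = u} = suffix′ (path u) refl

  ≼-trans : ∀ {s t u} → s ≼ t → t ≼ u → s ≼ u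
  ≼-trans {s} s≼t t≼u with suffix t≼u
  ... | pre , eq = subst (s ∈ₗ_) (sym eq) (∈-++⁺ʳ pre s≼t)

  private
    path-injective : ∀ {s t} → path s ≡ path t → s ≡ t
    path-injective {s} {t} eq with path-cons s | path-cons t
    ... | _ , eqₛ , _ | _ , eqₜ , _ with trans (sym eqₛ) (trans eq eqₜ)
    ... | refl = refl

  ≼-antisym : ∀ {s t} → s ≼ t → t ≼ s → s ≡ t
  ≼-antisym {s} {t} s≼t t≼s with suffix s≼t | suffix t≼s
  ... | [] , eq | _ = path-injective (sym eq)
  ... | _ ∷ _ , _ | [] , eq = path-injective eq
  ... | p ∷ pre , eq | pre′ , eq′ = contradiction le (ℕ.<⇒≱ lt)
    where
    lt : length (path s) ℕ.< length (path t)
    lt = subst (length (path s) ℕ.<_) (sym (trans (cong length eq) (cong suc (length-++ pre))))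
           (s≤s (ℕ.m≤n+m _ (length pre)))
    le : length (path t) ℕ.≤ length (path s)
    le = subst (length (path t) ℕ.≤_) (sym (trans (cong length eq′) (length-++ pre′))) (ℕ.m≤n+m _ (length pre′))

  Edge : Fin m → Fin m → Set
  Edge a b = (a , b) ∈ₗ T ⊎ (b , a) ∈ₗ T

  -- Every edge joins a node to its parent, so the only edge out of the subtree of `t` leads from
  -- `t` to its parent.
  edge-leaves : ∀ {a b t} → Edge a b → t ≼ a → ¬ t ≼ b → a ≡ t × b ≼ a
  edge-leaves {a} {b} {t} e t≼a t⋠b = go (oriented e)
    where
    oriented : Edge a b → path a ≡ a ∷ path b ⊎ path b ≡ b ∷ path a
    oriented (inj₁ e) = path-edge e
    oriented (inj₂ e) = Sum.swap (path-edge e)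
    go : path a ≡ a ∷ path b ⊎ path b ≡ b ∷ path a → a ≡ t × b ≼ a
    go (inj₂ eq) = contradiction (subst (t ∈ₗ_) (sym eq) (there t≼a)) t⋠b
    go (inj₁ eq) with subst (t ∈ₗ_) eq t≼a
    ... | here t≡a = sym t≡a , subst (b ∈ₗ_) (sym eq) (there ≼-refl)
    ... | there t≼b = contradiction t≼b t⋠b

  Topmost : (Fin m → Set) → Fin m → Set
  Topmost Q t = Q t × (∀ {p} → p ≼ t → Q p → p ≡ t)

  private
    topmost′ : ∀ {Q} → (∀ t → Dec (Q t)) → ∀ l {u} → path u ≡ l →
      (∀ {p} → p ∈ₗ l → ¬ Q p) ⊎ ∃ λ t → t ∈ₗ l × Topmost Q t
    topmost′ Q? [] _ = inj₁ λ ()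
    topmost′ {Q} Q? (x ∷ r) {u} eq with path-cons u
    ... | r′ , eq′ , tail with trans (sym eq) eq′
    ... | refl with rest tail
      where
      rest : r ≡ [] ⊎ (∃ λ p → r ≡ path p) → (∀ {p} → p ∈ₗ r → ¬ Q p) ⊎ ∃ λ t → t ∈ₗ r × Topmost Q t
      rest (inj₁ refl) = inj₁ λ ()
      rest (inj₂ (p , r≡)) = topmost′ Q? r (sym r≡)
    ... | inj₂ (t , t∈ , top) = inj₂ (t , there t∈ , top)
    ... | inj₁ none with Q? x
    ... | no ¬q = inj₁ λ { (here refl) → ¬q ; (there p∈) → none p∈ }
    ... | yes q = inj₂ (x , here refl , q , unique)
      where
      unique : ∀ {p} → p ≼ x → Q p → p ≡ x
      unique {p} p≼ qp with subst (p ∈ₗ_) eq p≼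
      ... | here p≡ = p≡
      ... | there p∈ = contradiction qp (none p∈)

  topmost : ∀ {Q} → (∀ t → Dec (Q t)) → ∀ {t₀} → Q t₀ → ∃ λ t → t ≼ t₀ × Topmost Q t
  topmost Q? {t₀} q with topmost′ Q? (path t₀) refl
  ... | inj₁ none = contradiction q (none ≼-refl)
  ... | inj₂ found = found

  -- Leaving the subtree of `t` means stepping to the parent of `t`, where `Q` holds too, although
  -- `t` is topmost.
  topmost-reach : ∀ {P Q t a b} → (∀ {x} → P x → Q x) → Topmost Q t → t ≼ a → Reach T P a b → t ≼ b
  topmost-reach _ _ t≼a (here _) = t≼a
  topmost-reach {t = t} P⇒Q top t≼a (step {b = b} _ e w) with t ≼? b
  ... | yes t≼b = topmost-reach P⇒Q top t≼b w
  ... | no t⋠b with edge-leaves e t≼a t⋠b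
  ... | refl , b≼t = contradiction (subst (t ≼_) (sym (proj₂ top b≼t (P⇒Q (reach-start w)))) ≼-refl) t⋠b
    where
    reach-start : ∀ {P a b} → Reach T P a b → P a
    reach-start (here p) = p
    reach-start (step p _ _) = p

  -- Induction from the root downwards. The motive is on lists because paths, unlike nodes, decrease
  -- structurally.
  path-induction : ∀ {p} (P : List (Fin m) → Set p) → P [] →
    (∀ {t r} → path t ≡ t ∷ r → P r → P (t ∷ r)) → ∀ t → P (path t)
  path-induction P base ind t = go (path t) refl
    where
    go : ∀ l {t} → path t ≡ l → P l
    go [] _ = base
    go (_ ∷ r) {t} eq with path-cons t
    ... | r′ , eq′ , tail with trans (sym eq) eq′
    ... | refl = ind eq (rest tail)
      where
      rest : r ≡ [] ⊎ (∃ λ p → r ≡ path p) → P r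
      rest (inj₁ refl) = base
      rest (inj₂ (p , r≡)) = go r (sym r≡)

-- Cores and the stack

module Cores {n : ℕ} {E : List (WEdge n)} (nonneg : NonNegWeights E) {k : ℕ} (td : TreeDecomposition E k)
             (rooted : Rooting (TreeDecomposition.tedges td)) {ρ : ℚ} (ρ≥0 : 0ℚ ≤ ρ) where

  open TreeDecomposition td
  open Walks E nonneg
  open RootedTree rooted
  open Rooting rooted using (path; path-cons)

  -- Separation by bags

  Below : Fin m → Fin n → Set
  Below t w = ∃ λ t′ → t ≼ t′ × w ∈ₗ bag t′

  -- Depth is what makes the load countable: every bag of a deep vertex has `t` on its path to the
  -- root, so any one of them can be used to find `t`.
  Deep : Fin m → Fin n → Set
  Deep t w = ∀ t′ → w ∈ₗ bag t′ → t ≼ t′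

  abstract
    below? : ∀ t w → Dec (Below t w)
    below? t w = Fin.any? λ t′ → t ≼? t′ ×-dec w ∈ₗ? bag t′

    deep? : ∀ t w → Dec (Deep t w)
    deep? t w = Fin.all? λ t′ → w ∈ₗ? bag t′ →-dec t ≼? t′

  deep⇒below : ∀ {t w} → Deep t w → Below t w
  deep⇒below {w = w} deep with cover w
  ... | t′ , w∈ = t′ , deep t′ w∈ , w∈

  bag⇒below : ∀ {t w} → w ∈ₗ bag t → Below t w
  bag⇒below w∈ = _ , ≼-refl , w∈

  -- The nodes whose bags hold `w` are connected, and the only way out of the subtree of `t` passes
  -- through `t` itself.
  separator : ∀ {t w b} → Below t w → w ∈ₗ bag b → ¬ t ≼ b → w ∈ₗ bag t
  separator {t} {w} {b} (a , t≼a , w∈a) w∈b t⋠b = go t≼a (subtree w a b w∈a w∈b)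
    where
    go : ∀ {a} → t ≼ a → Reach tedges (λ t → w ∈ₗ bag t) a b → w ∈ₗ bag t
    go t≼a (here _) = contradiction t≼a t⋠b
    go t≼a (step {b = c} w∈ e r) with t ≼? c
    ... | yes t≼c = go t≼c r
    ... | no t⋠c with edge-leaves e t≼a t⋠c
    ... | refl , _ = w∈

  below⇒bag⊎deep : ∀ {t w} → Below t w → w ∈ₗ bag t ⊎ Deep t w
  below⇒bag⊎deep {t} {w} below with w ∈ₗ? bag t
  ... | yes w∈ = inj₁ w∈
  ... | no w∉ = inj₂ λ t′ w∈′ → decidable-stable (t ≼? t′) λ t⋠ → w∉ (separator below w∈′ t⋠)

  bag-above : ∀ {s t z} → z ∈ₗ bag s → s ≼ t → Below t z → z ∈ₗ bag t
  bag-above {s} {t} z∈ s≼t below with t ≼? s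
  ... | no t⋠s = separator below z∈ t⋠s
  ... | yes t≼s with ≼-antisym s≼t t≼s
  ... | refl = z∈

  adj-bag : ∀ {u v q} → Adj E u v q → ∃ λ t → u ∈ₗ bag t × v ∈ₗ bag t
  adj-bag (inj₁ e) = edgeIn _ _ _ e
  adj-bag (inj₂ e) with edgeIn _ _ _ e
  ... | t , v∈ , u∈ = t , u∈ , v∈

  -- Adjacent vertices share a bag, so a walk cannot leave the part below `t` without using a vertex
  -- of the bag of `t`. The cut is made at the first such vertex, hence the first piece stays below
  -- `t`.
  walk-crosses-bag : ∀ {P t w z ℓ} → Walk E P w z ℓ → Below t w → (Below t z → z ∈ₗ bag t) →
    ∃ λ q → q ∈ₗ bag t × ∃ λ ℓ₁ → ∃ λ ℓ₂ →
      Walk E (λ x → P x × Below t x) w q ℓ₁ × Walk E P q z ℓ₂ × ℓ₁ + ℓ₂ ≡ ℓ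
  walk-crosses-bag {t = t} {w} {ℓ = ℓ} wk below leaves with w ∈ₗ? bag t
  ... | yes w∈ = w , w∈ , 0ℚ , ℓ , here (walk-start wk , below) , wk , ℚ.+-identityˡ ℓ
  walk-crosses-bag (here p) below leaves | no w∉ = contradiction (leaves below) w∉
  walk-crosses-bag {t = t} (step {q = q} p e wk) below leaves | no w∉ with adj-bag e
  ... | c , w∈c , v∈c with t ≼? c
  ... | no t⋠c = contradiction (separator below w∈c t⋠c) w∉
  ... | yes t≼c with walk-crosses-bag wk (c , t≼c , v∈c) leaves
  ... | x , x∈ , ℓ₁ , ℓ₂ , wk₁ , wk₂ , eq =
    x , x∈ , q + ℓ₁ , ℓ₂ , step (p , below) e wk₁ , wk₂ , trans (ℚ.+-assoc q ℓ₁ ℓ₂) (cong (q +_) eq)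

  InCore : Fin m → Subset n → Fin n → Set
  InCore s H w = ∃ λ z → z ∈ₗ bag s × Within E (λ x → x ∈ H × Below s x) ρ w z

  abstract
    inCore? : ∀ s H w → Dec (InCore s H w)
    inCore? s H w = any∈? (within? (λ x → x ∈? H ×-dec below? s x) ρ w) (bag s)

  core : Fin m → Subset n → Subset n
  core s H = comprehension (inCore? s H)

  Meets : Fin m → Subset n → Set
  Meets t S = ∃ λ x → x ∈ₗ bag t × x ∈ S

  abstract
    meets? : ∀ t S → Dec (Meets t S)
    meets? t S = any∈? (_∈? S) (bag t)

  -- What is left of H for the frames above (s , H) on the stack.  A vertex below a node t
  -- at which (s , H) is popped is kept only if the frame (t , H) that replaces it would capture it.
  InShrink : Fin m → Subset n → Fin n → Set
  InShrink s H w = w ∈ H × w ∉ core s H ×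
    (∀ t → s ≼ t → ¬ Meets t (core s H) → Below t w → w ∈ core t H)

  abstract
    inShrink? : ∀ s H w → Dec (InShrink s H w)
    inShrink? s H w = w ∈? H ×-dec ¬? (w ∈? core s H) ×-dec
      Fin.all? λ t → s ≼? t →-dec ¬? (meets? t (core s H)) →-dec below? t w →-dec w ∈? core t H

  shrink : Fin m → Subset n → Subset n
  shrink s H = comprehension (inShrink? s H)

  ∈-shrink⁻ : ∀ {s H w} → w ∈ shrink s H → InShrink s H w
  ∈-shrink⁻ = ∈-comprehension⁻ (inShrink? _ _)

  core⊆ : ∀ {s H w} → w ∈ core s H → w ∈ H
  core⊆ w∈ with ∈-comprehension⁻ (inCore? _ _) w∈
  ... | _ , _ , _ , wk , _ = proj₁ (walk-start wk)

  shrink⊆ : ∀ {s H w} → w ∈ shrink s H → w ∈ H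
  shrink⊆ = proj₁ ∘ ∈-shrink⁻

  bag∩⊆core : ∀ {s H w} → w ∈ₗ bag s → w ∈ H → w ∈ core s H
  bag∩⊆core w∈ w∈H = ∈-comprehension⁺ (inCore? _ _) (_ , w∈ , 0ℚ , here (w∈H , bag⇒below w∈) , ρ≥0)

  -- The walk that puts `w` in the core crosses the bag of `t`, and its second piece puts the
  -- crossing vertex in the core. So a core missed by the bag of `t` has no vertex below `t`.
  core-meets : ∀ {s t H w} → w ∈ core s H → s ≼ t → Below t w → Meets t (core s H)
  core-meets w∈ s≼t below with ∈-comprehension⁻ (inCore? _ _) w∈
  ... | z , z∈ , ℓ , wk , ≤ρ with walk-crosses-bag wk below (bag-above z∈ s≼t)
  ... | q , q∈ , ℓ₁ , ℓ₂ , wk₁ , wk₂ , refl = q , q∈ , ∈-comprehension⁺ (inCore? _ _)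
    (z , z∈ , ℓ₂ , wk₂ , ℚ.≤-trans (≤-prepend (walk-nonneg wk₁) ℚ.≤-refl) ≤ρ)

  push : Fin m → Subset n → List (Fin m) → List (Fin m)
  push t H [] = t ∷ []
  push t H (s ∷ ss) with meets? t (core s H)
  ... | yes _ = s ∷ push t (shrink s H) ss
  ... | no _ = t ∷ []

  avail : Fin m → Subset n → List (Fin m) → Subset n
  avail t H [] = H
  avail t H (s ∷ ss) with meets? t (core s H)
  ... | yes _ = avail t (shrink s H) ss
  ... | no _ = H

  stack : List (Fin m) → List (Fin m)
  stack [] = []
  stack (t ∷ r) = push t ⊤ (stack r)

  home : List (Fin m) → Subset n
  home [] = ⊤
  home (t ∷ r) = avail t ⊤ (stack r)

  Home : Fin m → Subset n
  Home s = home (path s)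

  -- The stack stores nodes only; the set of a frame results from applying `shrink` for each frame
  -- beneath it. The index is the height.
  data Frame : ℕ → Subset n → List (Fin m) → Fin m → Subset n → Set where
    bottom : ∀ {H s ss} → Frame zero H (s ∷ ss) s H
    above : ∀ {i H s ss s′ H′} → Frame i (shrink s H) ss s′ H′ → Frame (suc i) H (s ∷ ss) s′ H′

  frame⊆ : ∀ {i H ss s H′ w} → Frame i H ss s H′ → w ∈ H′ → w ∈ H
  frame⊆ bottom w∈ = w∈
  frame⊆ (above f) w∈ = shrink⊆ (frame⊆ f w∈)

  frame-∈ : ∀ {i H ss s H′} → Frame i H ss s H′ → s ∈ₗ ss
  frame-∈ bottom = here refl
  frame-∈ (above f) = there (frame-∈ f)

  frame-< : ∀ {i H ss s H′} → Frame i H ss s H′ → i ℕ.< length ss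
  frame-< bottom = s≤s z≤n
  frame-< (above f) = s≤s (frame-< f)

  avail⊆ : ∀ {t H w} ss → w ∈ avail t H ss → w ∈ H
  avail⊆ [] w∈ = w∈
  avail⊆ {t} {H} (s ∷ ss) w∈ with meets? t (core s H)
  ... | yes _ = shrink⊆ (avail⊆ ss w∈)
  ... | no _ = w∈

  push-frame : ∀ t H ss → ∃ λ i → Frame i H (push t H ss) t (avail t H ss)
  push-frame t H [] = zero , bottom
  push-frame t H (s ∷ ss) with meets? t (core s H)
  ... | no _ = zero , bottom
  ... | yes _ with push-frame t (shrink s H) ss
  ... | i , f = suc i , above f

  push-frame⁻ : ∀ {i t H s′ H′} ss → Frame i H (push t H ss) s′ H′ →
    (s′ ≡ t × H′ ≡ avail t H ss) ⊎ ∃ λ j → Frame j H ss s′ H′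
  push-frame⁻ [] bottom = inj₁ (refl , refl)
  push-frame⁻ {t = t} {H} (s ∷ ss) f with meets? t (core s H)
  push-frame⁻ (s ∷ ss) bottom | no _ = inj₁ (refl , refl)
  push-frame⁻ (s ∷ ss) bottom | yes _ = inj₂ (zero , bottom)
  push-frame⁻ (s ∷ ss) (above f) | yes _ = Sum.map₂ (λ (j , f′) → suc j , above f′) (push-frame⁻ ss f)

  push-∈⁻ : ∀ {t H s′} ss → s′ ∈ₗ push t H ss → s′ ≡ t ⊎ s′ ∈ₗ ss
  push-∈⁻ [] (here eq) = inj₁ eq
  push-∈⁻ {t} {H} (s ∷ ss) s′∈ with meets? t (core s H)
  push-∈⁻ (s ∷ ss) (here eq) | no _ = inj₁ eq
  push-∈⁻ (s ∷ ss) (here eq) | yes _ = inj₂ (here eq)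
  push-∈⁻ (s ∷ ss) (there s′∈) | yes _ = Sum.map₂ there (push-∈⁻ ss s′∈)

  stack-⊆ : ∀ l {s} → s ∈ₗ stack l → s ∈ₗ l
  stack-⊆ (t ∷ r) s∈ with push-∈⁻ (stack r) s∈
  ... | inj₁ eq = here eq
  ... | inj₂ s∈′ = there (stack-⊆ r s∈′)

  -- A push leaves the frames under the cut unchanged, so a frame keeps the set it was created with.
  -- This allows clusters to be defined from nodes alone.
  frame-home : ∀ t {i s H} → Frame i ⊤ (stack (path t)) s H → H ≡ Home s
  frame-home = path-induction (λ l → ∀ {i s H} → Frame i ⊤ (stack l) s H → H ≡ Home s) (λ ()) ind
    where
    ind : ∀ {t r} → path t ≡ t ∷ r → (∀ {i s H} → Frame i ⊤ (stack r) s H → H ≡ Home s) →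
          ∀ {i s H} → Frame i ⊤ (stack (t ∷ r)) s H → H ≡ Home s
    ind {r = r} eq ih f with push-frame⁻ (stack r) f
    ... | inj₁ (refl , refl) = cong home (sym eq)
    ... | inj₂ (_ , f′) = ih f′

  -- The cores of the frames that survive a push are disjoint and all meet the bag.
  push-length : ∀ t H ss → length (push t H ss) ℕ.≤ suc (length (filter (_∈? H) (bag t)))
  push-length t H [] = s≤s z≤n
  push-length t H (s ∷ ss) with meets? t (core s H)
  ... | no _ = s≤s z≤n
  ... | yes (x , x∈ , x∈core) = s≤s (ℕ.≤-trans (push-length t (shrink s H) ss)
    (length-filter-< (_∈? shrink s H) (_∈? H) shrink⊆ x∈ (core⊆ x∈core)
      λ x∈′ → proj₁ (proj₂ (∈-shrink⁻ x∈′)) x∈core))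

  stack-length : ∀ l → length (stack l) ℕ.≤ suc (suc k)
  stack-length [] = z≤n
  stack-length (t ∷ r) = ℕ.≤-trans (push-length t ⊤ (stack r))
    (s≤s (ℕ.≤-trans (length-filter (_∈? ⊤) (bag t)) (width t)))

  -- Clusters

  Region : Fin m → Fin n → Fin n → Set
  Region s z x = x ∈ Home s × (Deep s x ⊎ x ≡ z)

  -- The balls of all `s` whose bag holds `z` are merged. They share the center, so the radius is
  -- unchanged, and the load becomes a count of centers.
  InCluster : Fin n → Fin n → Set
  InCluster z w = ∃ λ s → z ∈ₗ bag s × Within E (Region s z) (ρ + ρ) w z

  abstract
    inCluster? : ∀ z w → Dec (InCluster z w)
    inCluster? z w = Fin.any? λ s → z ∈ₗ? bag s ×-dec
      within? (λ x → x ∈? Home s ×-dec (deep? s x ⊎-dec x Fin.≟ z)) (ρ + ρ) w z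

  cluster : Fin n → Subset n
  cluster z = comprehension (inCluster? z)

  cluster-center : ∀ {z w} → w ∈ cluster z → Within E (_∈ cluster z) (ρ + ρ) w z
  cluster-center {z} w∈ with ∈-comprehension⁻ (inCluster? z) w∈
  ... | s , z∈ , near = within-map (λ near′ → ∈-comprehension⁺ (inCluster? z) (s , z∈ , near′))
                                   (within-localize near)

  cluster-diam : ∀ z → StrongDiam≤ E (cluster z) ((ρ + ρ) + (ρ + ρ))
  cluster-diam z u v u∈ v∈ = within-++ (cluster-center u∈) (within-reverse (cluster-center v∈))

  -- Stop at the first vertex in the bag of `s`: all vertices before it are deep. The price is a new
  -- center `z′`.
  walk-to-bag : ∀ {P s w z ℓ} → Walk E P w z ℓ → (∀ {x} → P x → Below s x) → z ∈ₗ bag s →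
    ∃ λ z′ → z′ ∈ₗ bag s × Within E (λ x → P x × (Deep s x ⊎ x ≡ z′)) ℓ w z′
  walk-to-bag wk below z∈ with below⇒bag⊎deep (below (walk-start wk))
  ... | inj₁ w∈ = _ , w∈ , 0ℚ , here (walk-start wk , inj₂ refl) , walk-nonneg wk
  walk-to-bag (here p) below z∈ | inj₂ _ = _ , z∈ , 0ℚ , here (p , inj₂ refl) , ℚ.≤-refl
  walk-to-bag (step {q = q} p e wk) below z∈ | inj₂ deep with walk-to-bag wk below z∈
  ... | z′ , z′∈ , ℓ′ , wk′ , ≤ℓ = z′ , z′∈ , q + ℓ′ , step (p , inj₁ deep) e wk′ , ℚ.+-monoʳ-≤ q ≤ℓ

  -- Covering of balls

  module Ball (D : Subset n) (near : ∀ {x y} → x ∈ D → y ∈ D → Within E (_∈ D) ρ x y) where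

    -- Follow a walk inside `D`. The bags of each of its vertices form a connected set of nodes that
    -- meet `D`, and consecutive vertices share a bag, so the subtree of `t` is never left.
    topmost-deep : ∀ {t a v w} → Topmost (λ t → Meets t D) t → v ∈ₗ bag a → t ≼ a →
      v ∈ D → w ∈ D → Deep t w
    topmost-deep {t} top v∈a t≼a v∈D w∈D b w∈b = go (proj₁ (proj₂ (near v∈D w∈D))) v∈a t≼a
      where
      move : ∀ {x a b} → x ∈ D → x ∈ₗ bag a → x ∈ₗ bag b → t ≼ a → t ≼ b
      move {x} x∈D x∈a x∈b t≼a = topmost-reach (λ x∈ → x , x∈ , x∈D) top t≼a (subtree x _ _ x∈a x∈b)
      go : ∀ {v a ℓ} → Walk E (_∈ D) v _ ℓ → v ∈ₗ bag a → t ≼ a → t ≼ b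
      go (here v∈D) v∈a t≼a = move v∈D v∈a w∈b t≼a
      go (step v∈D e wk) v∈a t≼a with adj-bag e
      ... | c , v∈c , v′∈c = go wk v′∈c (move v∈D v∈a v∈c t≼a)

    module _ {t x} (x∈ : x ∈ₗ bag t) (x∈D : x ∈ D) where

      ⊆-shrink : ∀ {s H} → s ≼ t → Meets t (core s H) → ¬ (∃ λ w → w ∈ D × w ∈ core s H) →
        (∀ {w} → w ∈ D → w ∈ H) → ∀ {w} → w ∈ D → w ∈ shrink s H
      ⊆-shrink {s} {H} s≼t (y , y∈ , y∈core) missed D⊆H {w} w∈D =
        ∈-comprehension⁺ (inShrink? s H) (D⊆H w∈D , (λ w∈core → missed (w , w∈D , w∈core)) , captured)
        where
        captured : ∀ t′ → s ≼ t′ → ¬ Meets t′ (core s H) → Below t′ w → w ∈ core t′ H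
        captured t′ s≼t′ popped below with near w∈D x∈D
        -- The node `t` is not below `t′`: otherwise `y` would be a core vertex below `t′`, and the
        -- core would meet the bag of `t′`. So the walk from `w` to `x` must cross that bag.
        ... | ℓ , wk , ≤ρ with walk-crosses-bag wk below (λ x-below → separator x-below x∈ λ t′≼t →
                               popped (core-meets y∈core s≼t′ (t , t′≼t , y∈)))
        ... | q , q∈ , ℓ₁ , ℓ₂ , wk₁ , wk₂ , refl = ∈-comprehension⁺ (inCore? t′ H)
          (q , q∈ , ℓ₁ , walk-map (λ (d , b) → D⊆H d , b) wk₁ ,
           ℚ.≤-trans (subst (_≤ ℓ₁ + ℓ₂) (ℚ.+-identityʳ ℓ₁) (ℚ.+-monoʳ-≤ ℓ₁ (walk-nonneg wk₂))) ≤ρ)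

      -- Climb the stack while cores miss `D`; by `⊆-shrink` all of `D` survives each level. At the
      -- latest the new frame of `t` is hit, since `x` lies in its bag.
      catch : ∀ H ss → (∀ {s} → s ∈ₗ ss → s ≼ t) → (∀ {w} → w ∈ D → w ∈ H) →
        ∃ λ i → ∃ λ s → ∃ λ H′ → Frame i H (push t H ss) s H′ ×
          (∃ λ w → w ∈ D × w ∈ core s H′) × (∀ {w} → w ∈ D → w ∈ H′)
      catch H [] _ D⊆H = _ , t , H , bottom , (x , x∈D , bag∩⊆core x∈ (D⊆H x∈D)) , D⊆H
      catch H (s ∷ ss) above-t D⊆H with meets? t (core s H)
      ... | no _ = _ , t , H , bottom , (x , x∈D , bag∩⊆core x∈ (D⊆H x∈D)) , D⊆H
      ... | yes meets with Fin.any? (λ w → w ∈? D ×-dec w ∈? core s H)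
      ... | yes hit = _ , s , H , bottom , hit , D⊆H
      ... | no missed with catch (shrink s H) ss (above-t ∘ there)
                                 (⊆-shrink (above-t (here refl)) meets missed D⊆H)
      ... | i , s′ , H′ , f , hit , D⊆H′ = suc i , s′ , H′ , above f , hit , D⊆H′

    ball-in-cluster : ∀ {v} → v ∈ D → ∃ λ z → ∀ {w} → w ∈ D → w ∈ cluster z
    ball-in-cluster {v} v∈D with cover v
    ... | a , v∈a with topmost (λ t → meets? t D) (v , v∈a , v∈D)
    ... | t , t≼a , top@((x , x∈ , x∈D) , _) = inside caught
      where
      caught : ∃ λ i → ∃ λ s → ∃ λ H → Frame i ⊤ (stack (path t)) s H ×
        (∃ λ w → w ∈ D × w ∈ core s H) × (∀ {w} → w ∈ D → w ∈ H)
      caught with path-cons t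
      ... | r , eq , _ = subst (λ l → ∃ λ i → ∃ λ s → ∃ λ H → Frame i ⊤ (stack l) s H ×
          (∃ λ w → w ∈ D × w ∈ core s H) × (∀ {w} → w ∈ D → w ∈ H)) (sym eq)
        (catch x∈ x∈D ⊤ (stack r) (λ s∈ → subst (_ ∈ₗ_) (sym eq) (there (stack-⊆ r s∈))) (λ _ → ∈⊤))
      inside : _ → ∃ λ z → ∀ {w} → w ∈ D → w ∈ cluster z
      inside (i , s , H , f , (y , y∈D , y∈core) , D⊆H)
        with frame-home t f | ∈-comprehension⁻ (inCore? s H) y∈core
      ... | refl | z₀ , z₀∈ , ℓ , wk , ≤ρ with walk-to-bag wk proj₂ z₀∈
      -- From `w` go at most ρ to `y` inside `D`, then at most ρ to `z`. Vertices deep for `t` are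
      -- deep for its ancestor `s`.
      ... | z , z∈ , ℓ′ , wk′ , ≤ℓ = z , λ w∈D → ∈-comprehension⁺ (inCluster? z)
        ( s , z∈ , within-++
          (within-map (λ x∈D → D⊆H x∈D , inj₁ λ b x∈b → ≼-trans s≼t (topmost-deep top v∈a t≼a v∈D x∈D b x∈b))
                      (near w∈D y∈D))
          (ℓ′ , walk-map (λ ((x∈H , _) , c) → x∈H , c) wk′ , ℚ.≤-trans ≤ℓ ≤ρ))
        where
        s≼t : s ≼ t
        s≼t = stack-⊆ (path t) (frame-∈ f)

  -- Load

  module Load {u τ} (u∈τ : u ∈ₗ bag τ) where

    -- Depth is relaxed to `Below`, the condition used in cores, so that short pieces of the walk
    -- certify membership in a core.
    SeenFrom : Fin m → Subset n → Set
    SeenFrom s H = ∃ λ z → z ∈ₗ bag s × Within E (λ x → x ∈ H × Below s x) (ρ + ρ) u z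

    Seen : Fin m → Set
    Seen s = SeenFrom s (Home s)

    -- Split the walk at the bag of `t`. One piece has length at most ρ; a short second piece would
    -- make the core of `s` meet the bag, so the first is short and ends in the bag of `t`.
    replaced : ∀ {s t H} → s ≼ t → Below t u → ¬ Meets t (core s H) → SeenFrom s H → u ∈ core t H
    replaced {s} {t} {H} s≼t below popped (z , z∈ , ℓ , wk , ≤2ρ)
      with walk-crosses-bag wk below (bag-above z∈ s≼t)
    ... | q , q∈ , ℓ₁ , ℓ₂ , wk₁ , wk₂ , refl with ℓ₁ ≤? ρ | ℓ₂ ≤? ρ
    ... | yes ≤ρ | _ = ∈-comprehension⁺ (inCore? t H)
      (q , q∈ , ℓ₁ , walk-map (λ ((x∈H , _) , b) → x∈H , b) wk₁ , ≤ρ)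
    ... | no _ | yes ≤ρ = contradiction (q , q∈ , ∈-comprehension⁺ (inCore? s H) (z , z∈ , ℓ₂ , wk₂ , ≤ρ)) popped
    ... | no ≰₁ | no ≰₂ = ⊥-elim (ℚ.<-irrefl refl (ℚ.<-≤-trans (ℚ.+-mono-< (ℚ.≰⇒> ≰₁) (ℚ.≰⇒> ≰₂)) ≤2ρ))

    -- Only the lowest popped frame needs `replaced`. If a frame above it sees `u`, then `u` lies in
    -- `shrink s H`, whose last condition gives the capture.
    push-uncaptured : ∀ {t} → Below t u → ∀ H ss → (∀ {s} → s ∈ₗ ss → s ≼ t) →
      (∃ λ i → Frame i H (push t H ss) t (avail t H ss) × u ∈ core t (avail t H ss)) ⊎
      (∀ {i s H′} → Frame i H ss s H′ → SeenFrom s H′ → ∃ λ j → Frame j H (push t H ss) s H′)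
    push-uncaptured below H [] _ = inj₂ λ ()
    push-uncaptured {t} below H (s ∷ ss) above-t with meets? t (core s H)
    ... | yes _ with push-uncaptured below (shrink s H) ss (above-t ∘ there)
    ...   | inj₁ (i , f , u∈) = inj₁ (suc i , above f , u∈)
    ...   | inj₂ keep = inj₂ λ { bottom _ → zero , bottom
                               ; (above f) seen → let j , f′ = keep f seen in suc j , above f′ }
    push-uncaptured {t} below H (s ∷ ss) above-t | no popped with u ∈? core t H
    ... | yes u∈ = inj₁ (zero , bottom , u∈)
    ... | no u∉ = inj₂ λ { bottom seen → contradiction (replaced (above-t (here refl)) below popped seen) u∉
                         ; (above f) (_ , _ , _ , wk , _) → contradiction
                             (proj₂ (proj₂ (∈-shrink⁻ (frame⊆ f (proj₁ (walk-start wk)))))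
                               t (above-t (here refl)) popped below) u∉ }

    -- A frame with `u` in its core is never the lowest popped one, by `core-meets`. It survives and
    -- hides `u` from the new frame, or a lower frame is popped and `shrink` hands `u` to the
    -- replacement there.
    push-captured : ∀ {t} → Below t u → ∀ H ss → (∀ {s} → s ∈ₗ ss → s ≼ t) →
      ∀ {i s H′} → Frame i H ss s H′ → u ∈ core s H′ →
      (Frame i H (push t H ss) s H′ × u ∉ avail t H ss) ⊎
      (∃ λ j → j ℕ.< i × Frame j H (push t H ss) t (avail t H ss) × u ∈ core t (avail t H ss))
    push-captured {t} below H (s ∷ ss) above-t bottom u∈ with meets? t (core s H)
    ... | yes _ = inj₁ (bottom , λ u∈′ → proj₁ (proj₂ (∈-shrink⁻ (avail⊆ ss u∈′))) u∈)
    ... | no popped = contradiction (core-meets u∈ (above-t (here refl)) below) popped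
    push-captured {t} below H (s ∷ ss) above-t (above f) u∈ with meets? t (core s H)
    ... | no popped = inj₂ (zero , s≤s z≤n , bottom ,
            proj₂ (proj₂ (∈-shrink⁻ (frame⊆ f (core⊆ u∈)))) t (above-t (here refl)) popped below)
    ... | yes _ with push-captured below (shrink s H) ss (above-t ∘ there) f u∈
    ...   | inj₁ (f′ , u∉) = inj₁ (above f′ , u∉)
    ...   | inj₂ (j , j<i , f′ , u∈′) = inj₂ (suc j , s≤s j<i , above f′ , u∈′)

    -- At the moment of capture at most `suc (suc (suc k))` nodes are listed, the new one and a full
    -- stack; `suc k` is the greatest height.
    bound : ℕ
    bound = suc (suc (suc k)) ℕ.+ suc k

    -- The sum of `length seen` and the height is a potential: a node is added to `seen` only when
    -- the capturing frame moves to a smaller height.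
    data Phase (l : List (Fin m)) : Set where
      free : (∀ {s} → s ∈ₗ l → Seen s → ∃ λ i → Frame i ⊤ (stack l) s (Home s)) → Phase l
      captured : ∀ {i s H} → Frame i ⊤ (stack l) s H → u ∈ core s H →
        (seen : List (Fin m)) → length seen ℕ.+ i ℕ.≤ bound → (∀ {s} → s ∈ₗ l → Seen s → s ∈ₗ seen) → Phase l

    phase-step : ∀ {t r} → path t ≡ t ∷ r → Below t u → Phase r → Phase (t ∷ r)
    phase-step {t} {r} eq below phase = advance phase
      where
      above-t : ∀ {s} → s ∈ₗ stack r → s ≼ t
      above-t s∈ = subst (_ ∈ₗ_) (sym eq) (there (stack-⊆ r s∈))
      home-t : Home t ≡ avail t ⊤ (stack r)
      home-t = cong home eq
      advance : Phase r → Phase (t ∷ r)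
      advance (free on-stack) with push-uncaptured below ⊤ (stack r) above-t
      ... | inj₂ keep = free λ
        { (here refl) _ → subst (λ H → ∃ λ i → Frame i ⊤ (stack (t ∷ r)) t H) (sym home-t) (push-frame t ⊤ (stack r))
        ; (there s∈) seen → keep (proj₂ (on-stack s∈ seen)) seen }
      ... | inj₁ (i , f , u∈) = captured f u∈ (t ∷ stack r)
        (ℕ.+-mono-≤ (s≤s (stack-length r)) (ℕ.s≤s⁻¹ (ℕ.≤-trans (frame-< f) (stack-length (t ∷ r)))))
        λ { (here refl) _ → here refl ; (there s∈) seen → there (frame-∈ (proj₂ (on-stack s∈ seen))) }
      advance (captured f u∈ seen ≤bound complete) with push-captured below ⊤ (stack r) above-t f u∈
      ... | inj₁ (f′ , u∉) = captured f′ u∈ seen ≤bound λ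
        { (here refl) (_ , _ , _ , wk , _) → contradiction (subst (u ∈_) home-t (proj₁ (walk-start wk))) u∉
        ; (there s∈) → complete s∈ }
      ... | inj₂ (j , j<i , f′ , u∈′) = captured f′ u∈′ (t ∷ seen)
        (ℕ.≤-trans (ℕ.≤-trans (ℕ.≤-reflexive (sym (ℕ.+-suc (length seen) j))) (ℕ.+-monoʳ-≤ (length seen) j<i)) ≤bound)
        λ { (here refl) _ → here refl ; (there s∈) s-seen → there (complete s∈ s-seen) }

    phase : Phase (path τ)
    phase = path-induction (λ l → (∀ {t} → t ∈ₗ l → t ≼ τ) → Phase l) (λ _ → free λ ())
      (λ eq ih ≼τ → phase-step eq (τ , ≼τ (here refl) , u∈τ) (ih (≼τ ∘ there))) τ id

    seen-nodes : ∃ λ seen → length seen ℕ.≤ bound × (∀ {s} → s ≼ τ → Seen s → s ∈ₗ seen)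
    seen-nodes with phase
    ... | free on-stack = stack (path τ) , ℕ.≤-trans (stack-length (path τ)) (ℕ.m≤n⇒m≤o+n 1 (ℕ.m≤m+n _ _)) ,
            λ s∈ seen → frame-∈ (proj₂ (on-stack s∈ seen))
    ... | captured _ _ seen ≤bound complete = seen , ℕ.≤-trans (ℕ.m≤m+n _ _) ≤bound , complete

    -- If `u` is deep for `s`, then `s` is on the path of `τ` and is among the seen nodes. The extra
    -- `u` covers the cluster centered at `u` itself, where depth may fail.
    centers : ∃ λ zs → length zs ℕ.≤ suc (bound * suc k) × (∀ {z} → u ∈ cluster z → z ∈ₗ zs)
    centers with seen-nodes
    ... | seen , ≤bound , complete = u ∷ concatMap bag seen ,
      s≤s (ℕ.≤-trans (length-concatMap bag width seen) (ℕ.*-monoˡ-≤ (suc k) ≤bound)) , found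
      where
      found : ∀ {z} → u ∈ cluster z → z ∈ₗ u ∷ concatMap bag seen
      found {z} u∈ with ∈-comprehension⁻ (inCluster? z) u∈
      ... | s , z∈ , near@(_ , wk , _) with proj₂ (walk-start wk)
      ... | inj₂ u≡z = here (sym u≡z)
      ... | inj₁ deep = there (∈-concat⁺′ z∈ (∈-map⁺ bag (complete (deep τ u∈τ) (z , z∈ , within-map lower near))))
        where
        lower : ∀ {x} → Region s z x → x ∈ Home s × Below s x
        lower (x∈H , inj₁ deep-x) = x∈H , deep⇒below deep-x
        lower (x∈H , inj₂ refl) = x∈H , bag⇒below z∈

  clusters : List (Subset n)
  clusters = map cluster (allFin n)

  cluster-load : ∀ u → load clusters u ℕ.≤ suc ((suc (suc (suc k)) ℕ.+ suc k) * suc k)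
  cluster-load u with cover u
  ... | τ , u∈τ with Load.centers u∈τ
  ... | zs , ≤len , complete = ℕ.≤-trans (ℕ.≤-reflexive (length-filter-map (u ∈?_) cluster (allFin n)))
    (ℕ.≤-trans (unique-⊆⇒length≤ (filter⁺ ((u ∈?_) ∘ cluster) (allFin⁺ n))
      (λ z∈ → complete (proj₂ (∈-filter⁻ ((u ∈?_) ∘ cluster) {xs = allFin n} z∈)))) ≤len)

-- The cover at one scale, and the constants

ball-near : ∀ {n} {E : List (WEdge n)} (nonneg : NonNegWeights E) {δ v} (D : Subset n) →
  (∀ {w} → w ∈ D → Dist≤ E w v δ) → (∀ {w} → Dist≤ E w v δ → w ∈ D) →
  ∀ {x y} → x ∈ D → y ∈ D → Within E (_∈ D) (δ + δ) x y
ball-near {E = E} nonneg {δ} {v} D D⁻ D⁺ x∈ y∈ = within-++ (to-center x∈) (within-reverse (to-center y∈))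
  where
  open Walks E nonneg
  to-center : ∀ {w} → w ∈ D → Within E (_∈ D) δ w v
  to-center w∈ = within-map D⁺ (within-localize (D⁻ w∈))

sparse-cover : ∀ {n} {E : List (WEdge n)} → NonNegWeights E → ∀ {k} → TreeDecomposition E k →
  ∀ {β} (pβ : Positive β) {s Δ} → let δ = radius Δ β pβ in
  0ℚ ≤ δ → ((δ + δ) + (δ + δ)) + ((δ + δ) + (δ + δ)) ≡ Δ →
  suc ((suc (suc (suc k)) ℕ.+ suc k) * suc k) ℕ.≤ s →
  Σ (List (Subset n)) λ 𝒞 → SparseCover E β pβ s Δ 𝒞
sparse-cover {n} {E} nonneg td {β} pβ {s} {Δ} δ≥0 eq ≤s = clusters , record
  { diam = All.map⁺ (All.universal (λ z → subst (StrongDiam≤ E (cluster z)) eq (cluster-diam z)) (allFin n))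
  ; balls = balls
  ; sparse = λ u → ℕ.≤-trans (cluster-load u) ≤s
  }
  where
  δ = radius Δ β pβ
  open Walks E nonneg using (within?)
  rooted : Rooting (TreeDecomposition.tedges td)
  rooted = rooting tconn (Fin.fromℕ< nodes≥1) edges
    where open TreeDecomposition td
  -- Here ρ is 2 δ, the diameter bound of a ball of radius δ measured inside it; cluster diameters
  -- are then at most 4 ρ = 8 δ = Δ.
  open Cores nonneg td rooted (ℚ.+-mono-≤ δ≥0 δ≥0)
  balls : (v : Fin n) → Σ (Subset n) λ C → C ∈ₗ clusters × ((u : Fin n) → Dist≤ E u v δ → u ∈ C)
  balls v = cluster (proj₁ found) , ∈-map⁺ cluster (∈-allFin (proj₁ found)) ,
            λ u d → proj₂ found (∈-comprehension⁺ ball? d)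
    where
    ball? : ∀ w → Dec (Dist≤ E w v δ)
    ball? w = within? (λ _ → yes tt) δ w v
    D = comprehension ball?
    near : ∀ {x y} → x ∈ D → y ∈ D → Within E (_∈ D) (δ + δ) x y
    near = ball-near nonneg D (∈-comprehension⁻ ball?) (∈-comprehension⁺ ball?)
    found : ∃ λ z → ∀ {w} → w ∈ D → w ∈ cluster z
    found = Ball.ball-in-cluster D near {v} (∈-comprehension⁺ ball? (0ℚ , here tt , δ≥0))

-- The load is quadratic in the bag size `suc k`. A single constant serves as factor and exponent,
-- so the exponent is raised from 2 to 5.
load-bound : ∀ k → suc ((suc (suc (suc k)) ℕ.+ suc k) * suc k) ℕ.≤ 5 * suc k ^ 5
load-bound k = begin
  1 ℕ.+ (2 ℕ.+ (K ℕ.+ K)) * K                        ≤⟨ ℕ.+-mono-≤ {1} {K * K} (s≤s z≤n) (ℕ.*-monoˡ-≤ K 2+2K≤4K) ⟩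
  K * K ℕ.+ ((K ℕ.+ K) ℕ.+ (K ℕ.+ K)) * K            ≡⟨ quadratic K ⟩
  5 * (K * K)                                        ≡⟨ cong (λ x → 5 * (K * x)) (sym (ℕ.*-identityʳ K)) ⟩
  5 * K ^ 2                                          ≤⟨ ℕ.*-monoʳ-≤ 5 (ℕ.^-monoʳ-≤ K (s≤s (s≤s (z≤n {3})))) ⟩
  5 * K ^ 5                                          ∎
  where
  open ℕ.≤-Reasoning
  K = suc k
  2+2K≤4K : 2 ℕ.+ (K ℕ.+ K) ℕ.≤ (K ℕ.+ K) ℕ.+ (K ℕ.+ K)
  2+2K≤4K = ℕ.+-monoˡ-≤ (K ℕ.+ K) (ℕ.+-mono-≤ {1} {K} {1} {K} (s≤s z≤n) (s≤s z≤n))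
  quadratic : ∀ x → x * x ℕ.+ ((x ℕ.+ x) ℕ.+ (x ℕ.+ x)) * x ≡ 5 * (x * x)
  quadratic = solve-∀

theorem2 : Σ ℚ λ β → Σ (Positive β) λ pβ → Σ ℕ λ c →
    (n : ℕ) (E : List (WEdge n)) → NonNegWeights E → Connected E →
    (tw : ℕ) → Treewidth E tw →
    SparseCoverScheme E β pβ (c * suc tw ^ c)
theorem2 = 8ℚ , _ , 5 , λ n E nonneg _ tw (td , _) Δ Δ>0 →
  sparse-cover nonneg td {8ℚ} _ {Δ = Δ} (δ≥0 Δ Δ>0) (eight Δ) (load-bound tw)
  where
  8ℚ ⅛ : ℚ
  -- Dividing by `8ℚ` computes to multiplying by `⅛`, so the facts below apply to `radius` as they
  -- stand.
  8ℚ = ℤ.+ 8 / 1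
  ⅛ = ℤ.+ 1 / 8
  δ≥0 : ∀ Δ → Positive Δ → 0ℚ ≤ Δ ℚ* ⅛
  δ≥0 Δ Δ>0 = ℚ.<⇒≤ (ℚ.positive⁻¹ (Δ ℚ* ⅛) {{ℚ.pos*pos⇒pos Δ {{Δ>0}} ⅛}})
  double : ∀ Δ {x} y → x ≡ Δ ℚ* y → x + x ≡ Δ ℚ* (y + y)
  double Δ y refl = sym (ℚ.*-distribˡ-+ Δ y y)
  eight : ∀ Δ → let δ = Δ ℚ* ⅛ in ((δ + δ) + (δ + δ)) + ((δ + δ) + (δ + δ)) ≡ Δ
  eight Δ = trans (double Δ _ (double Δ _ (double Δ ⅛ refl))) (ℚ.*-identityʳ Δ)
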